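{- For every positive integer $n$, $$\frac{\lfloor n/2\rfloor!}{2^{\lfloor n/2\rfloor}}\;\leq\; M(n,2)\;\leq\; 2^{\lceil n/2\rceil}\,\lceil n/2\rceil!,$$ where $M(n,2)$ is the largest cardinality of a family of Hamilton paths in the complete graph $K_n$ such that for any two distinct members of the family there is a path on 3 vertices (2 edges) both of whose edges are contained in one of the two Hamilton paths and neither of whose edges belongs to the other.
   Context: $K_n$ is the complete graph with vertex set $[n]=\{1,\dots,n\}$. Hamilton paths are undirected: a Hamilton path in $K_n$ is a subgraph that is a path visiting all $n$ vertices, identified with its edge set (so a vertex ordering and its reversal give the same Hamilton path). -}

module Defs where

open import Data.Fin.Base using (Fin)
open import Data.Integer.Base using (+_)
open import Data.List.Base using (List; []; _∷_)
open import Data.List.Membership.Propositional using (_∈_)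
open import Data.List.Relation.Binary.Infix.Heterogeneous using (Infix)
open import Data.List.Relation.Unary.Unique.Propositional using (Unique)
open import Data.Nat.Base using (ℕ; _≤_; _^_; _!; ⌊_/2⌋)
open import Data.Nat.Properties using (m^n≢0)
open import Data.Product.Base using (∃-syntax; _×_)
open import Data.Rational.Unnormalised.Base using (ℚᵘ; _/_)
open import Data.Sum.Base using (_⊎_)
open import Function.Bundles using (_⇔_)
open import Function.Definitions using (Injective)
open import Relation.Binary.PropositionalEquality.Core using (_≡_; _≢_)
open import Relation.Nullary.Negation.Core using (¬_)

-- The vertex set [n] is rendered as Fin n.  A Hamilton path is presented by one
-- of its vertex orderings; equality of Hamilton paths is _≈_ below, not _≡_.
record HamiltonPath (n : ℕ) : Set where
  field
    vertices : List (Fin n)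
    distinct : Unique vertices
    spanning : ∀ v → v ∈ vertices

open HamiltonPath public

Edge : ∀ {n} → HamiltonPath n → Fin n → Fin n → Set
Edge H u v = Infix _≡_ (u ∷ v ∷ []) (vertices H)
           ⊎ Infix _≡_ (v ∷ u ∷ []) (vertices H)

-- Equality of edge sets, so an ordering and its reversal are identified.
infix 4 _≈_
_≈_ : ∀ {n} → HamiltonPath n → HamiltonPath n → Set
H ≈ K = ∀ u v → Edge H u v ⇔ Edge K u v

-- A path u – v – w on three vertices with both edges in H and neither in K.
HasP₃Outside : ∀ {n} → HamiltonPath n → HamiltonPath n → Set
HasP₃Outside H K = ∃[ u ] ∃[ v ] ∃[ w ]
  (u ≢ v × v ≢ w × u ≢ w) ×
  (Edge H u v × Edge H v w) ×
  (¬ Edge K u v × ¬ Edge K v w)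

Separated : ∀ {n} → HamiltonPath n → HamiltonPath n → Set
Separated H K = HasP₃Outside H K ⊎ HasP₃Outside K H

-- Injectivity with respect to _≈_ makes m the cardinality of the family.
record SeparatedFamily (n m : ℕ) : Set where
  field
    member    : Fin m → HamiltonPath n
    injective : Injective _≡_ _≈_ member
    separated : ∀ i j → ¬ (member i ≈ member j) → Separated (member i) (member j)

-- M(n,2) = m.
M[_,2]≡_ : ℕ → ℕ → Set
M[ n ,2]≡ m = SeparatedFamily n m × (∀ k → SeparatedFamily n k → k ≤ m)

lowerBound : ℕ → ℚᵘ
lowerBound n = _/_ (+ (⌊ n /2⌋ !)) (2 ^ ⌊ n /2⌋) {{m^n≢0 2 ⌊ n /2⌋}}

{-# OPTIONS --safe #-}
-- Upper bound: every two consecutive edges of a Hamilton path contain one of its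
-- first, third, fifth, … edges.  Hence two paths with the same such edges are not
-- separated, and these edges form a perfect matching of 2⌈n/2⌉ points (one of them
-- a dummy when n is odd), of which there are (2⌈n/2⌉ − 1)!! ≤ 2^⌈n/2⌉ ⌈n/2⌉!.
--
-- Lower bound: put k = ⌊n/2⌋ and consider the paths a₁ b₁ a₂ b₂ … a_k b_k with the aᵢ
-- fixed and the bᵢ drawn without repetition, alternately from two disjoint pools of
-- sizes ⌈k/2⌉ and ⌊k/2⌋.  At the first i where two such paths differ, aᵢ bᵢ aᵢ₊₁ of the
-- one avoids the edges of the other, which visits bᵢ at least two slots later.
-- Their number ⌈k/2⌉! ⌊k/2⌋! satisfies k! ≤ 2^k ⌈k/2⌉! ⌊k/2⌋! because k ≤ 2⌈k/2⌉.
--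
-- The maximum exists constructively because separated families of a given size
-- can be searched for among finitely many vertex orderings.
module Submission where

open import Defs
open import Data.Integer.Base using (+_)
open import Data.Nat.Base using (ℕ; NonZero; _*_; _^_; _≤_; _!; ⌈_/2⌉)
open import Data.Product.Base using (∃-syntax; _×_)
open import Data.Rational.Unnormalised.Base using (_/_) renaming (_≤_ to _≤ᵘ_)

open import Data.Empty using (⊥)
open import Data.Fin.Base using (Fin; zero; suc; remQuot; combine; finToFun; funToFin)
import Data.Fin.Properties as Fin
import Data.Integer.Base as ℤ
import Data.Integer.Properties as ℤ
open import Data.List.Base as List using (List; []; _∷_; _++_)
open import Data.List.Membership.Propositional using (_∈_)
open import Data.List.Membership.Propositional.Properties
  using (∈-++⁺ʳ; ∈-++⁺ˡ; ∈-allFin; ∈-cartesianProductWith⁺)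
import Data.List.Membership.DecPropositional as DecMembership
import Data.List.Properties as List
open import Data.List.Relation.Binary.Infix.Heterogeneous using (Infix; here; there)
open import Data.List.Relation.Binary.Infix.Heterogeneous.Properties using (infix?)
open import Data.List.Relation.Binary.Permutation.Propositional
  using (_↭_; ↭-refl; ↭-sym; ↭-trans; ↭-reflexive; prep; swap; ↭⇒↭ₛ; module PermutationReasoning)
open import Data.List.Relation.Binary.Permutation.Propositional.Properties
  using (∈-resp-↭; ↭-length; map⁺; ++⁺ˡ; ++⁺ʳ; shift; shifts; drop-∷)
open import Data.List.Membership.Propositional.Properties.WithK using (unique∧set⇒bag)
open import Data.List.Relation.Binary.BagAndSetEquality using (∼bag⇒↭)
import Data.List.Relation.Binary.Permutation.Setoid.Properties as SetoidPerm
open import Data.List.Relation.Binary.Prefix.Heterogeneous using ([]; _∷_)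
open import Data.List.Relation.Unary.All as All using ([]; _∷_)
open import Data.List.Relation.Unary.AllPairs.Core using ([]; _∷_)
open import Data.List.Relation.Unary.Any as Any using (Any; here; there)
import Data.List.Relation.Unary.Any.Properties as Any
open import Data.List.Relation.Unary.Unique.Propositional using (Unique)
import Data.List.Relation.Unary.Unique.DecPropositional as DecUnique
open import Data.List.Relation.Unary.Unique.Propositional.Properties
  using (Unique[x∷xs]⇒x∉xs; allFin⁺)
open import Data.Maybe.Base as Maybe using (Maybe; just; nothing)
import Data.Maybe.Relation.Unary.Any as MAny
open import Data.Nat.Base using (zero; suc; _+_; _∸_; ⌊_/2⌋)
import Data.Nat.Properties as ℕ
open import Data.Product.Base using (_,_; proj₁; proj₂; uncurry)
import Data.Rational.Unnormalised.Base as ℚᵘ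
import Data.Rational.Unnormalised.Properties as ℚᵘ
open import Data.Sum.Base as Sum using (_⊎_; inj₁; inj₂; [_,_]′)
open import Data.Vec.Base as Vec using (Vec; []; _∷_; lookup; removeAt; toList)
import Data.Vec.Properties as Vec
open import Function.Base using (_∘_; id)
open import Function.Bundles using (_⇔_; mk⇔; module Equivalence)
open import Relation.Binary.PropositionalEquality
open import Relation.Nullary.Decidable using (Dec; dec⇒maybe; yes; no; map′; _×-dec_; _⊎-dec_; ¬?)
open import Relation.Nullary.Negation.Core using (¬_; contradiction)
open import Relation.Unary using (Decidable)

private variable
  A : Set
  a b c x : A
  xs : List A
  n : ℕ

-- Adjacency in lists; `Edge H` unfolds to `Adjacent (vertices H)`.

Adjacent : List A → A → A → Set
Adjacent xs u v = Infix _≡_ (u ∷ v ∷ []) xs ⊎ Infix _≡_ (v ∷ u ∷ []) xs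

infix-∈ˡ : Infix _≡_ (a ∷ b ∷ []) xs → a ∈ xs
infix-∈ˡ (here (p ∷ _)) = here p
infix-∈ˡ (there i)      = there (infix-∈ˡ i)

infix-∈ʳ : Infix _≡_ (a ∷ b ∷ []) (x ∷ xs) → b ∈ xs
infix-∈ʳ (here (_ ∷ p ∷ _))         = here p
infix-∈ʳ {xs = _ ∷ _} (there i)     = there (infix-∈ʳ i)
infix-∈ʳ {xs = []}    (there (here ()))

-- Without repetition `b` has a single position, so the two occurrences overlap there.
infix-join : Unique xs → Infix _≡_ (a ∷ b ∷ []) xs → Infix _≡_ (b ∷ c ∷ []) xs →
             Infix _≡_ (a ∷ b ∷ c ∷ []) xs
infix-join u (here (refl ∷ refl ∷ _)) (here (refl ∷ _)) =
  contradiction (here refl) (Unique[x∷xs]⇒x∉xs u)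
infix-join u (here (refl ∷ refl ∷ _)) (there (here (refl ∷ p))) = here (refl ∷ refl ∷ p)
infix-join (_ ∷ u) (here (refl ∷ refl ∷ _)) (there (there i)) =
  contradiction (infix-∈ˡ i) (Unique[x∷xs]⇒x∉xs u)
infix-join u i@(there _) (here (refl ∷ _)) = contradiction (infix-∈ʳ i) (Unique[x∷xs]⇒x∉xs u)
infix-join (_ ∷ u) (there i) (there j) = there (infix-join u i j)

successor-unique : Unique xs → Infix _≡_ (a ∷ b ∷ []) xs → Infix _≡_ (a ∷ c ∷ []) xs → b ≡ c
successor-unique u (here (refl ∷ p ∷ _)) (here (refl ∷ q ∷ _)) = trans p (sym q)
successor-unique u (here (refl ∷ _)) (there j) = contradiction (infix-∈ˡ j) (Unique[x∷xs]⇒x∉xs u)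
successor-unique u (there i) (here (refl ∷ _)) = contradiction (infix-∈ˡ i) (Unique[x∷xs]⇒x∉xs u)
successor-unique (_ ∷ u) (there i) (there j)   = successor-unique u i j

predecessor-unique : Unique xs → Infix _≡_ (a ∷ c ∷ []) xs → Infix _≡_ (b ∷ c ∷ []) xs → a ≡ b
predecessor-unique u (here (p ∷ _)) (here (q ∷ _)) = trans p (sym q)
predecessor-unique (_ ∷ u) (here (_ ∷ refl ∷ _)) (there j) =
  contradiction (infix-∈ʳ j) (Unique[x∷xs]⇒x∉xs u)
predecessor-unique (_ ∷ u) (there i) (here (_ ∷ refl ∷ _)) =
  contradiction (infix-∈ʳ i) (Unique[x∷xs]⇒x∉xs u)
predecessor-unique (_ ∷ u) (there i) (there j) = predecessor-unique u i j

-- If `a` and `c` both came right before `b`, or both right after it, they would coincide; so the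
-- two edges run in the same direction.
adjacent-join : Unique xs → a ≢ c → Adjacent xs a b → Adjacent xs b c →
                Infix _≡_ (a ∷ b ∷ c ∷ []) xs ⊎ Infix _≡_ (c ∷ b ∷ a ∷ []) xs
adjacent-join u a≢c (inj₁ i) (inj₁ j) = inj₁ (infix-join u i j)
adjacent-join u a≢c (inj₁ i) (inj₂ j) = contradiction (predecessor-unique u i j) a≢c
adjacent-join u a≢c (inj₂ i) (inj₁ j) = contradiction (successor-unique u i j) a≢c
adjacent-join u a≢c (inj₂ i) (inj₂ j) = inj₂ (infix-join u j i)

vertices↭allFin : (H : HamiltonPath n) → vertices H ↭ List.allFin n
vertices↭allFin {n} H = ∼bag⇒↭ (unique∧set⇒bag (distinct H) (allFin⁺ n)
  (mk⇔ (λ _ → ∈-allFin _) (λ _ → spanning H _)))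

-- Enumeration of perfect matchings

endpoints : List (A × A) → List A
endpoints []             = []
endpoints ((a , b) ∷ ps) = a ∷ b ∷ endpoints ps

Joined : List (A × A) → A → A → Set
Joined []             a b = ⊥
Joined ((u , v) ∷ ps) a b = (a ≡ u × b ≡ v ⊎ a ≡ v × b ≡ u) ⊎ Joined ps a b

infix 4 _≋_
-- Matchings are compared as sets of undirected edges: neither the order nor the orientation of the
-- pairs counts.
_≋_ : List (A × A) → List (A × A) → Set
ps ≋ qs = ∀ a b → Joined ps a b ⇔ Joined qs a b

≋-refl : {ps : List (A × A)} → ps ≋ ps
≋-refl _ _ = mk⇔ id id

≋-sym : {ps qs : List (A × A)} → ps ≋ qs → qs ≋ ps
≋-sym e a b = mk⇔ (from (e a b)) (to (e a b)) where open Equivalence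

≋-trans : {ps qs rs : List (A × A)} → ps ≋ qs → qs ≋ rs → ps ≋ rs
≋-trans e f a b = mk⇔ (to (f a b) ∘ to (e a b)) (from (e a b) ∘ from (f a b)) where open Equivalence

≋-cons : {ps qs : List (A × A)} (p : A × A) → ps ≋ qs → p ∷ ps ≋ p ∷ qs
≋-cons p e a b = mk⇔ (Sum.map₂ (to (e a b))) (Sum.map₂ (from (e a b))) where open Equivalence

≋-flip : (a b : A) (ps : List (A × A)) → (a , b) ∷ ps ≋ (b , a) ∷ ps
≋-flip a b ps _ _ = mk⇔ (Sum.map₁ Sum.swap) (Sum.map₁ Sum.swap)

≋-swap : (p q : A × A) (ps : List (A × A)) → p ∷ q ∷ ps ≋ q ∷ p ∷ ps
≋-swap p q ps _ _ = mk⇔ exchange exchange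
  where
  exchange : ∀ {P Q R : Set} → P ⊎ Q ⊎ R → Q ⊎ P ⊎ R
  exchange (inj₁ p)        = inj₂ (inj₁ p)
  exchange (inj₂ (inj₁ q)) = inj₁ q
  exchange (inj₂ (inj₂ r)) = inj₂ (inj₂ r)

Joined-sym : (ps : List (A × A)) → Joined ps a b → Joined ps b a
Joined-sym (p ∷ ps) (inj₁ (inj₁ (e , f))) = inj₁ (inj₂ (f , e))
Joined-sym (p ∷ ps) (inj₁ (inj₂ (e , f))) = inj₁ (inj₁ (f , e))
Joined-sym (p ∷ ps) (inj₂ j)              = inj₂ (Joined-sym ps j)

-- Brings the pair of `x` to the front, where `matching` has it.
extract : (ps : List (A × A)) → x ∈ endpoints ps →
          ∃[ y ] ∃[ qs ] endpoints ps ↭ x ∷ y ∷ endpoints qs × ps ≋ (x , y) ∷ qs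
extract ((a , b) ∷ ps) (here refl)         = b , ps , ↭-refl , ≋-refl {ps = (a , b) ∷ ps}
extract ((a , b) ∷ ps) (there (here refl)) = a , ps , swap _ _ ↭-refl , ≋-flip a b ps
extract ((a , b) ∷ ps) (there (there x∈)) with extract ps x∈
... | y , qs , σ , e = y , (a , b) ∷ qs
  , ↭-trans (prep _ (prep _ σ)) (shifts (a ∷ b ∷ []) (_ ∷ y ∷ []))
  , ≋-trans {qs = (a , b) ∷ (_ , y) ∷ qs} (≋-cons (a , b) e) (≋-swap (a , b) (_ , y) qs)

removeAt-↭ : (xs : Vec A (suc n)) (i : Fin (suc n)) →
             toList xs ↭ lookup xs i ∷ toList (removeAt xs i)
removeAt-↭ (x ∷ xs)         zero    = ↭-refl
removeAt-↭ (x ∷ xs@(_ ∷ _)) (suc i) = ↭-trans (prep x (removeAt-↭ xs i)) (swap _ _ ↭-refl)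

lookup-index : (xs : Vec A n) → x ∈ toList xs → ∃[ i ] lookup xs i ≡ x
lookup-index (y ∷ xs) (here refl) = zero , refl
lookup-index (y ∷ xs) (there x∈)  = let i , e = lookup-index xs x∈ in suc i , e

-- (2c − 1)!!, the number of perfect matchings of K₂c.
matchings : ℕ → ℕ
matchings zero    = 1
matchings (suc c) = suc (c * 2) * matchings c

-- For 2c + 2 points, `remQuot` decodes the number into one of the 2c + 1 partners of `x` and the
-- number of a matching of the other 2c points.
matching : ∀ c → Vec A (c * 2) → Fin (matchings c) → List (A × A)
matching zero    []       _ = []
matching (suc c) (x ∷ xs) k = let i , k′ = remQuot (matchings c) k in
  (x , lookup xs i) ∷ matching c (removeAt xs i) k′

-- Induction that removes the first point and its partner. Counting from above only asks that every
-- matching be hit up to `_≋_`.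
matching-surjective : ∀ c (xs : Vec A (c * 2)) ps → endpoints ps ↭ toList xs →
                      ∃[ k ] ps ≋ matching c xs k
matching-surjective zero    []       []       σ = zero , ≋-refl {ps = []}
matching-surjective zero    []       (_ ∷ _)  σ with () ← ↭-length σ
matching-surjective (suc c) (x ∷ xs) ps σ with extract ps (∈-resp-↭ (↭-sym σ) (here refl))
... | y , qs , τ , e with drop-∷ (↭-trans (↭-sym τ) σ)
...   | ρ with lookup-index xs (∈-resp-↭ ρ (here refl))
...     | i , refl with matching-surjective c (removeAt xs i) qs
                          (drop-∷ (↭-trans ρ (removeAt-↭ xs i)))
...       | k , f = combine i k ,
  subst (λ (i′ , k′) → ps ≋ (x , lookup xs i′) ∷ matching c (removeAt xs i′) k′)
    (sym (Fin.remQuot-combine i k))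
    (≋-trans {qs = (x , lookup xs i) ∷ qs} e (≋-cons (x , lookup xs i) f))

-- Odd edges and the upper bound

-- The first, third, fifth, … edges; a last vertex left over is paired with nothing.
oddEdges : List A → List (Maybe A × Maybe A)
oddEdges []           = []
oddEdges (x ∷ [])     = (just x , nothing) ∷ []
oddEdges (x ∷ y ∷ xs) = (just x , just y) ∷ oddEdges xs

padding : ℕ → List (Maybe A)
padding zero          = []
padding (suc zero)    = nothing ∷ []
padding (suc (suc n)) = padding n

-- Reordering `xs` merely permutes the endpoints, since the padding depends on the length alone.
endpoints-oddEdges : (xs : List A) →
  endpoints (oddEdges xs) ≡ List.map just xs ++ padding (List.length xs)
endpoints-oddEdges []           = refl
endpoints-oddEdges (x ∷ [])     = refl
endpoints-oddEdges (x ∷ y ∷ xs) = cong (λ zs → just x ∷ just y ∷ zs) (endpoints-oddEdges xs)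

endpoints-oddEdges-↭ : {xs ys : List A} → xs ↭ ys → endpoints (oddEdges xs) ↭ endpoints (oddEdges ys)
endpoints-oddEdges-↭ {xs = xs} {ys} σ
  rewrite endpoints-oddEdges xs | endpoints-oddEdges ys | ↭-length σ = ++⁺ʳ _ (map⁺ just σ)

-- `matching` requires a vector of length `c * 2`; the dummy point fills it up for odd `n`.
padded : (xs : Vec A n) → ∃[ ys ] toList {n = ⌈ n /2⌉ * 2} ys ≡ endpoints (oddEdges (toList xs))
padded []           = [] , refl
padded (x ∷ [])     = _ ∷ _ ∷ [] , refl
padded (x ∷ y ∷ xs) = let ys , e = padded xs in
  just x ∷ just y ∷ ys , cong (λ zs → just x ∷ just y ∷ zs) e

-- Consecutive edges have positions of opposite parity. The recursion drops two vertices to preserve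
-- parity, hence two base cases.
oddEdges-cover : Infix _≡_ (a ∷ b ∷ c ∷ []) xs →
  Joined (oddEdges xs) (just a) (just b) ⊎ Joined (oddEdges xs) (just b) (just c)
oddEdges-cover (here (refl ∷ refl ∷ _))                = inj₁ (inj₁ (inj₁ (refl , refl)))
oddEdges-cover (there (here (refl ∷ refl ∷ refl ∷ _))) = inj₂ (inj₂ (oddEdges-head _))
  where
  oddEdges-head : ∀ {a b : A} xs → Joined (oddEdges (a ∷ b ∷ xs)) (just a) (just b)
  oddEdges-head _ = inj₁ (inj₁ (refl , refl))
oddEdges-cover (there (there i)) = Sum.map inj₂ inj₂ (oddEdges-cover i)

oddEdges⊆Adjacent : (xs : List A) → Joined (oddEdges xs) (just a) (just b) → Adjacent xs a b
oddEdges⊆Adjacent (x ∷ [])     (inj₁ (inj₁ (_ , ())))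
oddEdges⊆Adjacent (x ∷ [])     (inj₁ (inj₂ (() , _)))
oddEdges⊆Adjacent (x ∷ y ∷ xs) (inj₁ (inj₁ (refl , refl))) = inj₁ (here (refl ∷ refl ∷ []))
oddEdges⊆Adjacent (x ∷ y ∷ xs) (inj₁ (inj₂ (refl , refl))) = inj₂ (here (refl ∷ refl ∷ []))
oddEdges⊆Adjacent (x ∷ y ∷ xs) (inj₂ j) =
  Sum.map (λ i → there (there i)) (λ i → there (there i)) (oddEdges⊆Adjacent xs j)

-- By `adjacent-join` the path is a consecutive triple of `H`, so it contains an odd edge of `H`,
-- which `e` turns into an edge of `K`.
oddEdges≋⇒¬HasP₃Outside : (H K : HamiltonPath n) →
  oddEdges (vertices H) ≋ oddEdges (vertices K) → ¬ HasP₃Outside H K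
oddEdges≋⇒¬HasP₃Outside H K e (u , v , w , (_ , _ , u≢w) , (uv , vw) , ¬uv , ¬vw)
  with adjacent-join (distinct H) u≢w uv vw
... | inj₁ i = [ ¬uv ∘ transfer , ¬vw ∘ transfer ]′ (oddEdges-cover i)
  where
  transfer : ∀ {a b} → Joined (oddEdges (vertices H)) (just a) (just b) → Edge K a b
  transfer = oddEdges⊆Adjacent (vertices K) ∘ Equivalence.to (e _ _)
... | inj₂ i = [ ¬vw ∘ transfer , ¬uv ∘ transfer ]′ (oddEdges-cover i)
  where
  transfer : ∀ {a b} → Joined (oddEdges (vertices H)) (just b) (just a) → Edge K a b
  transfer = oddEdges⊆Adjacent (vertices K) ∘ Equivalence.to (e _ _) ∘ Joined-sym (oddEdges (vertices H))

oddEdges≋⇒¬Separated : (H K : HamiltonPath n) →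
  oddEdges (vertices H) ≋ oddEdges (vertices K) → ¬ Separated H K
oddEdges≋⇒¬Separated H K e = [ oddEdges≋⇒¬HasP₃Outside H K e
                             , oddEdges≋⇒¬HasP₃Outside K H (≋-sym e) ]′

toList-tabulate : (f : Fin n → A) → toList (Vec.tabulate f) ≡ List.tabulate f
toList-tabulate {n = zero}  f = refl
toList-tabulate {n = suc n} f = cong (f zero ∷_) (toList-tabulate (f ∘ suc))

-- Pigeonhole: with more members than matchings, two members would have the same odd edges, yet
-- `injective` makes the family separate them.
family-size≤matchings : ∀ {m} → SeparatedFamily n m → m ≤ matchings ⌈ n /2⌉
family-size≤matchings {n} {m} F = ℕ.≮⇒≥ λ small →
  let i , j , i<j , e = Fin.pigeonhole small (λ i → proj₁ (code i)) in
  oddEdges≋⇒¬Separated (member i) (member j)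
    (≋-trans {qs = matching _ (proj₁ base) (proj₁ (code i))} (proj₂ (code i))
      (subst (λ k → matching _ (proj₁ base) k ≋ oddEdges (vertices (member j))) (sym e)
        (≋-sym (proj₂ (code j)))))
    (separated i j (Fin.<⇒≢ i<j ∘ injective))
  where
  open SeparatedFamily F
  -- The 2⌈n/2⌉ points to be matched, taken from the identity ordering; the odd edges of every
  -- member have these endpoints up to order.
  base = padded (Vec.allFin n)
  code : ∀ i → ∃[ k ] oddEdges (vertices (member i)) ≋ matching ⌈ n /2⌉ (proj₁ base) k
  code i = matching-surjective ⌈ n /2⌉ (proj₁ base) (oddEdges (vertices (member i)))
    (↭-trans (endpoints-oddEdges-↭ (vertices↭allFin (member i)))
      (↭-reflexive (trans (cong (endpoints ∘ oddEdges) (sym (toList-tabulate {n = n} id))) (sym (proj₂ base)))))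

-- Raising each factor 2c + 1 to 2c + 2 turns (2c - 1)!! into (2c)!! = 2^c c!.
matchings≤ : ∀ c → matchings c ≤ 2 ^ c * c !
matchings≤ zero    = ℕ.≤-refl
matchings≤ (suc c) = begin
  suc (c * 2) * matchings c       ≤⟨ ℕ.*-mono-≤ (ℕ.n≤1+n (suc (c * 2))) (matchings≤ c) ⟩
  suc c * 2 * (2 ^ c * c !)       ≡⟨ cong (_* (2 ^ c * c !)) (ℕ.*-comm (suc c) 2) ⟩
  2 * suc c * (2 ^ c * c !)       ≡⟨ ℕ.[m*n]*[o*p]≡[m*o]*[n*p] 2 (suc c) (2 ^ c) (c !) ⟩
  2 ^ suc c * suc c !             ∎
  where open ℕ.≤-Reasoning

-- Weaves, the paths of the lower bound

-- ⌈k/2⌉! ⌊k/2⌋!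
weaves : ℕ → ℕ
weaves zero    = 1
weaves (suc k) = ⌈ suc k /2⌉ * weaves k

mutual
  -- The pools trade places at each draw, which makes the draws alternate; the sizes agree
  -- definitionally, as `⌊ suc k /2⌋` is `⌈ k /2⌉`.
  weave : ∀ k → Vec A k → Vec A ⌈ k /2⌉ → Vec A ⌊ k /2⌋ → List A → Fin (weaves k) → List A
  weave zero    []       []  [] rest _ = rest
  weave (suc k) (a ∷ as) xs  ys rest c = a ∷ draw k as xs ys rest (remQuot (weaves k) c)

  draw : ∀ k → Vec A k → Vec A ⌈ suc k /2⌉ → Vec A ⌊ suc k /2⌋ → List A →
         Fin ⌈ suc k /2⌉ × Fin (weaves k) → List A
  draw k as xs ys rest (i , c) = lookup xs i ∷ weave k as ys (removeAt xs i) rest c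

mutual
  -- Makes every weave an ordering of the same vertices, and later locates a vertex still waiting in
  -- its pool.
  weave-↭ : ∀ k (as : Vec A k) xs ys rest c →
            weave k as xs ys rest c ↭ toList as ++ toList xs ++ toList ys ++ rest
  weave-↭ zero    []       []  [] rest _ = ↭-refl
  weave-↭ (suc k) (a ∷ as) xs  ys rest c = prep a (draw-↭ k as xs ys rest (remQuot (weaves k) c))

  draw-↭ : ∀ k (as : Vec A k) xs ys rest c →
           draw k as xs ys rest c ↭ toList as ++ toList xs ++ toList ys ++ rest
  draw-↭ k as xs ys rest (i , c) = begin
    v ∷ weave k as ys xs′ rest c                        ↭⟨ prep v (weave-↭ k as ys xs′ rest c) ⟩
    v ∷ toList as ++ toList ys ++ toList xs′ ++ rest    ↭⟨ prep v (++⁺ˡ (toList as) (shifts (toList ys) (toList xs′))) ⟩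
    v ∷ toList as ++ toList xs′ ++ toList ys ++ rest    ↭⟨ shift v (toList as) _ ⟨
    toList as ++ v ∷ toList xs′ ++ toList ys ++ rest    ↭⟨ ++⁺ˡ (toList as) (++⁺ʳ _ (removeAt-↭ xs i)) ⟨
    toList as ++ toList xs ++ toList ys ++ rest         ∎
    where
    open PermutationReasoning
    v   = lookup xs i
    xs′ = removeAt xs i

-- `a x a′` is to be the separating path. The entry `z` stands between `a′` and the later `x`, so
-- that these are not neighbours in a duplicate-free second list.
data Diverge {A : Set} : List A → List A → Set where
  here  : ∀ {a x a′ x′ z xs ys} → x ∈ ys → Diverge (a ∷ x ∷ a′ ∷ xs) (a ∷ x′ ∷ a′ ∷ z ∷ ys)
  there : ∀ {a xs ys} → Diverge xs ys → Diverge (a ∷ xs) (a ∷ ys)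

lookup-∈ : (xs : Vec A n) (i : Fin n) → lookup xs i ∈ toList xs
lookup-∈ (x ∷ xs) zero    = here refl
lookup-∈ (x ∷ xs) (suc i) = there (lookup-∈ xs i)

lookup-∈-removeAt : (xs : Vec A (suc n)) {i j : Fin (suc n)} → i ≢ j →
                    lookup xs i ∈ toList (removeAt xs j)
lookup-∈-removeAt xs {i} {j} i≢j = subst (_∈ toList (removeAt xs j))
  (Vec.removeAt-punchOut xs (i≢j ∘ sym)) (lookup-∈ (removeAt xs j) _)

remQuot-injective : ∀ {m} n {c d : Fin (m * n)} → remQuot {m} n c ≡ remQuot n d → c ≡ d
remQuot-injective {m} n {c} {d} e = trans (sym (Fin.combine-remQuot {m} n c))
  (trans (cong (uncurry combine) e) (Fin.combine-remQuot {m} n d))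

mutual
  weave-diverge : ∀ k (as : Vec A k) xs ys rest {c d} → c ≢ d →
                  Diverge (weave k as xs ys rest c) (weave k as xs ys rest d)
  weave-diverge zero [] [] [] rest {zero} {zero} c≢d = contradiction refl c≢d
  weave-diverge (suc k) (a ∷ as) xs ys rest c≢d =
    draw-diverge k a as xs ys rest (c≢d ∘ remQuot-injective (weaves k))

  -- The fixed vertex `a` before the slot is included because the divergence starts with it.
  draw-diverge : ∀ k (a : A) (as : Vec A k) xs ys rest {c d} → c ≢ d →
                 Diverge (a ∷ draw k as xs ys rest c) (a ∷ draw k as xs ys rest d)
  draw-diverge k a as xs ys rest {i , c} {j , d} c≢d with i Fin.≟ j
  draw-diverge k a as xs ys rest {i , c} {.i , d} c≢d | yes refl =
    there (there (weave-diverge k as ys (removeAt xs i) rest (c≢d ∘ cong (i ,_))))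
  -- At the last slot the pool drawn from holds one vertex, so the draws agree.
  draw-diverge zero a [] xs ys rest {zero , _} {zero , _} c≢d | no i≢j = contradiction refl i≢j
  draw-diverge (suc k) a (a′ ∷ as) xs ys rest {i , c} {j , d} c≢d | no i≢j =
    -- The entry `z` comes from the other pool, so `lookup xs i`, still in its own pool, is placed
    -- after it.
    here (∈-resp-↭ (↭-sym (weave-↭ k as (removeAt xs j) _ rest _))
      (∈-++⁺ʳ (toList as) (∈-++⁺ˡ (lookup-∈-removeAt xs i≢j))))

-- From divergence to a path on three vertices

¬Adjacent-∷ : x ≢ a → x ≢ b → ¬ Adjacent xs a b → ¬ Adjacent (x ∷ xs) a b
¬Adjacent-∷ x≢a x≢b ¬ab (inj₁ (here (refl ∷ _))) = x≢a refl
¬Adjacent-∷ x≢a x≢b ¬ab (inj₁ (there i))         = ¬ab (inj₁ i)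
¬Adjacent-∷ x≢a x≢b ¬ab (inj₂ (here (refl ∷ _))) = x≢b refl
¬Adjacent-∷ x≢a x≢b ¬ab (inj₂ (there i))         = ¬ab (inj₂ i)

¬Adjacent-head : Unique (a ∷ b ∷ xs) → c ∈ xs → ¬ Adjacent (a ∷ b ∷ xs) a c
¬Adjacent-head (_ ∷ u) c∈ (inj₁ (here (_ ∷ refl ∷ _))) = Unique[x∷xs]⇒x∉xs u c∈
¬Adjacent-head u       c∈ (inj₁ (there i))             = Unique[x∷xs]⇒x∉xs u (infix-∈ˡ i)
¬Adjacent-head u       c∈ (inj₂ (here (refl ∷ _)))     = Unique[x∷xs]⇒x∉xs u (there c∈)
¬Adjacent-head u       c∈ (inj₂ (there i))             = Unique[x∷xs]⇒x∉xs u (there (infix-∈ʳ i))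

-- The memberships strengthen the induction: by uniqueness a vertex of the common prefix differs
-- from `u`, `v`, `w`, so prepending it creates no adjacency among them.
diverge⇒P₃ : {xs ys : List A} → Diverge xs ys → Unique ys →
  ∃[ u ] ∃[ v ] ∃[ w ] (u ∈ ys × v ∈ ys × w ∈ ys) × (u ≢ v × v ≢ w × u ≢ w) ×
  (Adjacent xs u v × Adjacent xs v w) × (¬ Adjacent ys u v × ¬ Adjacent ys v w)
diverge⇒P₃ (here {a} {x} {a′} x∈) uy@(ua ∷ ux′@(ux ∷ ua′@(ua″ ∷ uz))) = a , x , a′
  , (here refl , there (there (there (there x∈))) , there (there (here refl)))
  , (a≢x , a′≢x ∘ sym , All.lookup ua (there (here refl)))
  , (inj₁ (here (refl ∷ refl ∷ [])) , inj₁ (there (here (refl ∷ refl ∷ []))))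
  , ¬Adjacent-head uy (there (there x∈))
  -- Once `a` and `x′` are dropped, `a′` heads the list and has `z` as its only neighbour.
  , ¬Adjacent-∷ a≢x (All.lookup ua (there (here refl)))
      (¬Adjacent-∷ (All.lookup ux (there (there x∈))) (All.lookup ux (here refl))
        (¬Adjacent-head ua′ x∈ ∘ Sum.swap))
  where
  a≢x  = All.lookup ua (there (there (there x∈)))
  a′≢x = All.lookup ua″ (there x∈)
diverge⇒P₃ (there d) (p ∷ uy) with diverge⇒P₃ d uy
... | u , v , w , (u∈ , v∈ , w∈) , ≢s , (uv , vw) , ¬uv , ¬vw = u , v , w
  , (there u∈ , there v∈ , there w∈) , ≢s
  , (Sum.map there there uv , Sum.map there there vw)
  , ¬Adjacent-∷ (All.lookup p u∈) (All.lookup p v∈) ¬uv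
  , ¬Adjacent-∷ (All.lookup p v∈) (All.lookup p w∈) ¬vw

diverge⇒HasP₃Outside : (H K : HamiltonPath n) → Diverge (vertices H) (vertices K) → HasP₃Outside H K
diverge⇒HasP₃Outside H K d with diverge⇒P₃ d (distinct K)
... | u , v , w , _ , ≢s , es , ¬es = u , v , w , ≢s , es , ¬es

-- Separated families of weaves

↭allFin⇒HamiltonPath : {xs : List (Fin n)} → xs ↭ List.allFin n → HamiltonPath n
↭allFin⇒HamiltonPath {n} {xs} σ = record
  { vertices = xs
  ; distinct = SetoidPerm.Unique-resp-↭ (setoid _) (↭⇒↭ₛ (↭-sym σ)) (allFin⁺ n)
  ; spanning = λ v → ∈-resp-↭ (↭-sym σ) (∈-allFin v)
  }

≈-refl : {H : HamiltonPath n} → H ≈ H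
≈-refl _ _ = mk⇔ id id

HasP₃Outside⇒≉ : {H K : HamiltonPath n} → HasP₃Outside H K → ¬ H ≈ K
HasP₃Outside⇒≉ (u , v , _ , _ , (uv , _) , ¬uv , _) e = ¬uv (Equivalence.to (e u v) uv)

Separated⇒≉ : {H K : HamiltonPath n} → Separated H K → ¬ H ≈ K
Separated⇒≉ {H = H} {K} (inj₁ p) e = HasP₃Outside⇒≉ {H = H} {K} p e
Separated⇒≉ {H = H} {K} (inj₂ p) e = HasP₃Outside⇒≉ {H = K} {H} p
  λ u v → mk⇔ (Equivalence.from (e u v)) (Equivalence.to (e u v))

-- Separated paths have different edge sets, so one condition on indices yields both fields;
-- `separatedFamily?` searches for it in this form.
separatedFamily : ∀ {m} (f : Fin m → HamiltonPath n) →
                  (∀ i j → i ≡ j ⊎ Separated (f i) (f j)) → SeparatedFamily n m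
separatedFamily f s = record
  { member    = f
  ; injective = λ {i} {j} e → [ id , (λ p → contradiction e (Separated⇒≉ {H = f i} {f j} p)) ]′ (s i j)
  ; separated = λ i j ≉ → [ (λ { refl → contradiction (≈-refl {H = f i}) ≉ }) , id ]′ (s i j)
  }

-- The 2⌊n/2⌋ vertices used are split into a fixed sequence and two pools;
-- for odd n one vertex remains and is put at the end.
weaveFamily : ∀ k r → n ≡ k + (⌈ k /2⌉ + (⌊ k /2⌋ + r)) → SeparatedFamily n (weaves k)
weaveFamily k r refl
  with as , vs , p ← Vec.splitAt k (Vec.allFin (k + (⌈ k /2⌉ + (⌊ k /2⌋ + r))))
  with xs , ws , q ← Vec.splitAt ⌈ k /2⌉ vs
  with ys , zs , s ← Vec.splitAt ⌊ k /2⌋ ws = separatedFamily path separate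
  where
  allFin≡ : List.allFin _ ≡ toList as ++ toList xs ++ toList ys ++ toList zs
  allFin≡ = begin
    List.allFin _                                      ≡⟨ toList-tabulate id ⟨
    toList (Vec.allFin _)                              ≡⟨ cong toList p ⟩
    toList (as Vec.++ vs)                              ≡⟨ Vec.toList-++ as vs ⟩
    toList as ++ toList vs                             ≡⟨ cong (λ vs → toList as ++ toList vs) q ⟩
    toList as ++ toList (xs Vec.++ ws)                 ≡⟨ cong (toList as ++_) (Vec.toList-++ xs ws) ⟩
    toList as ++ toList xs ++ toList ws                ≡⟨ cong (λ ws → toList as ++ toList xs ++ toList ws) s ⟩
    toList as ++ toList xs ++ toList (ys Vec.++ zs)    ≡⟨ cong (λ us → toList as ++ toList xs ++ us) (Vec.toList-++ ys zs) ⟩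
    toList as ++ toList xs ++ toList ys ++ toList zs   ∎
    where open ≡-Reasoning

  path : Fin (weaves k) → HamiltonPath _
  path c = ↭allFin⇒HamiltonPath
    (↭-trans (weave-↭ k as xs ys (toList zs) c) (↭-reflexive (sym allFin≡)))

  separate : ∀ c d → c ≡ d ⊎ Separated (path c) (path d)
  separate c d with c Fin.≟ d
  ... | yes c≡d = inj₁ c≡d
  ... | no  c≢d = inj₂ (inj₁ (diverge⇒HasP₃Outside (path c) (path d)
                    (weave-diverge k as xs ys (toList zs) c≢d)))

-- Arithmetic of the lower bound

n≤⌈n/2⌉*2 : ∀ n → n ≤ ⌈ n /2⌉ * 2
n≤⌈n/2⌉*2 n = begin
  n                     ≡⟨ ℕ.⌊n/2⌋+⌈n/2⌉≡n n ⟨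
  ⌊ n /2⌋ + ⌈ n /2⌉     ≤⟨ ℕ.+-monoˡ-≤ ⌈ n /2⌉ (ℕ.⌊n/2⌋≤⌈n/2⌉ n) ⟩
  ⌈ n /2⌉ + ⌈ n /2⌉     ≡⟨ cong (λ h → ⌈ n /2⌉ + h) (ℕ.+-identityʳ ⌈ n /2⌉) ⟨
  2 * ⌈ n /2⌉           ≡⟨ ℕ.*-comm 2 ⌈ n /2⌉ ⟩
  ⌈ n /2⌉ * 2           ∎
  where open ℕ.≤-Reasoning

!≤weaves : ∀ k → k ! ≤ weaves k * 2 ^ k
!≤weaves zero    = ℕ.≤-refl
!≤weaves (suc k) = begin
  suc k * k !                                ≤⟨ ℕ.*-mono-≤ (n≤⌈n/2⌉*2 (suc k)) (!≤weaves k) ⟩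
  ⌈ suc k /2⌉ * 2 * (weaves k * 2 ^ k)       ≡⟨ ℕ.[m*n]*[o*p]≡[m*o]*[n*p] ⌈ suc k /2⌉ 2 (weaves k) (2 ^ k) ⟩
  weaves (suc k) * 2 ^ suc k                 ∎
  where open ℕ.≤-Reasoning

-- The leftover `⌈ n /2⌉ ∸ k` is 1 for odd and 0 for even `n`.
halves : ∀ n → let k = ⌊ n /2⌋ in n ≡ k + (⌈ k /2⌉ + (⌊ k /2⌋ + (⌈ n /2⌉ ∸ k)))
halves n = begin
  n                                           ≡⟨ ℕ.⌊n/2⌋+⌈n/2⌉≡n n ⟨
  k + ⌈ n /2⌉                                 ≡⟨ cong (λ h → k + h) (ℕ.m+[n∸m]≡n (ℕ.⌊n/2⌋≤⌈n/2⌉ n)) ⟨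
  k + (k + r)                                 ≡⟨ cong (λ h → k + (h + r)) (ℕ.⌊n/2⌋+⌈n/2⌉≡n k) ⟨
  k + (⌊ k /2⌋ + ⌈ k /2⌉ + r)                 ≡⟨ cong (λ h → k + (h + r)) (ℕ.+-comm ⌊ k /2⌋ ⌈ k /2⌉) ⟩
  k + (⌈ k /2⌉ + ⌊ k /2⌋ + r)                 ≡⟨ cong (λ h → k + h) (ℕ.+-assoc ⌈ k /2⌉ ⌊ k /2⌋ r) ⟩
  k + (⌈ k /2⌉ + (⌊ k /2⌋ + r))               ∎
  where
  open ≡-Reasoning
  k = ⌊ n /2⌋
  r = ⌈ n /2⌉ ∸ ⌊ n /2⌋

lowerBound≤ : ∀ n m → weaves ⌊ n /2⌋ ≤ m → lowerBound n ≤ᵘ (+ m) / 1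
lowerBound≤ n m w≤m = ℚᵘ.*≤* (subst₂ ℤ._≤_ lhs rhs (ℤ.+≤+ bound))
  where
  k = ⌊ n /2⌋
  instance _ = ℕ.m^n≢0 2 k
  bound : k ! ≤ m * 2 ^ k
  bound = ℕ.≤-trans (!≤weaves k) (ℕ.*-monoˡ-≤ (2 ^ k) w≤m)
  lhs : + (k !) ≡ ℚᵘ.↥ lowerBound n ℤ.* + 1
  lhs = sym (trans (ℤ.*-identityʳ _) (ℚᵘ.↥[n/d]≡n (+ (k !)) (2 ^ k)))
  rhs : + (m * 2 ^ k) ≡ + m ℤ.* ℚᵘ.↧ lowerBound n
  rhs = trans (ℤ.pos-* m (2 ^ k)) (cong (+ m ℤ.*_) (sym (ℚᵘ.↧[n/d]≡d (+ (k !)) (2 ^ k))))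

-- Finite search and the maximum

edge? : (H : HamiltonPath n) (u v : Fin n) → Dec (Edge H u v)
edge? H u v = infix? Fin._≟_ _ (vertices H) ⊎-dec infix? Fin._≟_ _ (vertices H)

hasP₃Outside? : (H K : HamiltonPath n) → Dec (HasP₃Outside H K)
hasP₃Outside? H K = Fin.any? λ u → Fin.any? λ v → Fin.any? λ w →
  (¬? (u Fin.≟ v) ×-dec ¬? (v Fin.≟ w) ×-dec ¬? (u Fin.≟ w)) ×-dec
  (edge? H u v ×-dec edge? H v w) ×-dec
  (¬? (edge? K u v) ×-dec ¬? (edge? K v w))

separated? : (H K : HamiltonPath n) → Dec (Separated H K)
separated? H K = hasP₃Outside? H K ⊎-dec hasP₃Outside? K H

-- Paths found by search may carry other proofs of `distinct` and `spanning`; edges depend on the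
-- vertex list alone.
HasP₃Outside-resp : {H H′ K K′ : HamiltonPath n} → vertices H ≡ vertices H′ → vertices K ≡ vertices K′ →
                    HasP₃Outside H K → HasP₃Outside H′ K′
HasP₃Outside-resp {H = record {}} {record {}} {record {}} {record {}} refl refl p = p

Separated-resp : {H H′ K K′ : HamiltonPath n} → vertices H ≡ vertices H′ → vertices K ≡ vertices K′ →
                 Separated H K → Separated H′ K′
Separated-resp {H = H} {H′} {K} {K′} e f =
  Sum.map (HasP₃Outside-resp {H = H} {H′} {K} {K′} e f) (HasP₃Outside-resp {H = K} {K′} {H} {H′} f e)

words : ∀ n → ℕ → List (List (Fin n))
words n zero    = [] ∷ []
words n (suc l) = List.cartesianProductWith _∷_ (List.allFin n) (words n l)

∈-words : (xs : List (Fin n)) → xs ∈ words n (List.length xs)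
∈-words []       = here refl
∈-words (x ∷ xs) = ∈-cartesianProductWith⁺ _∷_ (∈-allFin x) (∈-words xs)

path? : (xs : List (Fin n)) → Dec (∃[ H ] vertices {n} H ≡ xs)
path? xs = map′
  (λ (u , s) → record { vertices = xs ; distinct = u ; spanning = s } , refl)
  (λ { (H , refl) → distinct H , spanning H })
  (unique? xs ×-dec Fin.all? (_∈? xs))
  where
  open DecMembership Fin._≟_ using (_∈?_)
  open DecUnique Fin._≟_ using (unique?)

paths : ∀ n → List (HamiltonPath n)
paths n = List.mapMaybe (λ xs → Maybe.map proj₁ (dec⇒maybe (path? xs))) (words n n)

paths-complete : (H : HamiltonPath n) → Any (λ K → vertices K ≡ vertices H) (paths n)
paths-complete {n} H = Any.mapMaybe⁺ _ (words n n) (Any.map⁺ (Any.map found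
  (subst (λ l → vertices H ∈ words n l) length≡n (∈-words (vertices H)))))
  where
  length≡n : List.length (vertices H) ≡ n
  length≡n = trans (↭-length (vertices↭allFin H)) (List.length-tabulate id)
  found : ∀ {xs} → vertices H ≡ xs →
          MAny.Any (λ K → vertices K ≡ vertices H) (Maybe.map proj₁ (dec⇒maybe (path? xs)))
  found {xs} refl with path? xs
  ... | yes (K , e) = MAny.just e
  ... | no  ∄       = contradiction (H , refl) ∄

-- A choice of `m` listed paths is a function from `Fin m` to `Fin N`, coded as one number by
-- `funToFin`, so the search is finite.
separatedFamily? : ∀ n m → Dec (SeparatedFamily n m)
separatedFamily? n m = map′ (λ (c , s) → separatedFamily (path ∘ finToFun c) s) encode
  (Fin.any? λ c → Fin.all? λ i → Fin.all? λ j →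
    i Fin.≟ j ⊎-dec separated? (path (finToFun {N} c i)) (path (finToFun c j)))
  where
  N = List.length (paths n)
  path : Fin N → HamiltonPath n
  path = List.lookup (paths n)
  encode : SeparatedFamily n m →
           ∃[ c ] (∀ i j → i ≡ j ⊎ Separated (path (finToFun {N} c i)) (path (finToFun c j)))
  encode F = funToFin index , λ i j → separate i j (i Fin.≟ j)
    where
    open SeparatedFamily F
    index : Fin m → Fin N
    index i = Any.index (paths-complete (member i))
    copy : Fin m → HamiltonPath n
    copy = path ∘ finToFun (funToFin index)
    same : ∀ i → vertices (member i) ≡ vertices (copy i)
    same i = sym (trans (cong (vertices ∘ path) (Fin.finToFun-funToFin index i))
                        (Any.lookup-index (paths-complete (member i))))
    separate : ∀ i j → Dec (i ≡ j) → i ≡ j ⊎ Separated (copy i) (copy j)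
    separate i j (yes i≡j) = inj₁ i≡j
    separate i j (no  i≢j) = inj₂ (Separated-resp {H = member i} {copy i} {member j} {copy j}
                               (same i) (same j) (separated i j (i≢j ∘ injective)))

-- Descends from the bound to the first number satisfying `P`; if 0 is reached, the given witness
-- must be 0 itself.
maximum : {P : ℕ → Set} → Decidable P → ∀ {k} → P k → ∀ b → (∀ m → P m → m ≤ b) →
          ∃[ m ] P m × (∀ k → P k → k ≤ m)
maximum P? p zero    ≤b with refl ← ℕ.n≤0⇒n≡0 (≤b _ p) = 0 , p , ≤b
maximum P? p (suc b) ≤b with P? (suc b)
... | yes q = suc b , q , ≤b
... | no ¬q = maximum P? p b λ m q → ℕ.≤-pred (ℕ.≤∧≢⇒< (≤b m q) λ { refl → ¬q q })

theorem1 : ∀ (n : ℕ) → .{{_ : NonZero n}} →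
    ∃[ m ] M[ n ,2]≡ m
         × lowerBound n ≤ᵘ (+ m) / 1
         × m ≤ 2 ^ ⌈ n /2⌉ * ⌈ n /2⌉ !
-- `family` starts the search for the maximum and then, by maximality, bounds it from below.
theorem1 n = let m , F , max = maximum (separatedFamily? n) family _ (λ _ → family-size≤matchings) in
  m , (F , max) , lowerBound≤ n m (max _ family)
    , ℕ.≤-trans (family-size≤matchings F) (matchings≤ ⌈ n /2⌉)
  where
  family : SeparatedFamily n (weaves ⌊ n /2⌋)
  family = weaveFamily ⌊ n /2⌋ _ (halves n)
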